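{- Suppose that $\mathcal D=(\mathcal P,\mathcal B,\mathcal I)$ is a non-trivial $G$-pairwise transitive $2$-$(v,k,\lambda)$ design, where $G\le\mathrm{Aut}(\mathcal D)$, and that $G^{\mathcal B}$ has rank $3$. Let $r$ be the number of blocks incident with a point. Then $3\le k\le v/2$, $3\le r\le|\mathcal B|/2$, and for $b\in\mathcal B$, the stabiliser $G_b$ has an orbit on $\mathcal P$ of size $k$.
   Context: A design $\mathcal D=(\mathcal P,\mathcal B,\mathcal I)$ consists of finite sets $\mathcal P$ (points), $\mathcal B$ (blocks) and an incidence relation $\mathcal I\subseteq\mathcal P\times\mathcal B$. It is a $2$-$(v,k,\lambda)$ design (or $2$-design) if $|\mathcal P|=v$, each block is incident with exactly $k$ points, and each pair of distinct points is incident with exactly $\lambda$ common blocks. It is non-trivial if $2<k<v$. An automorphism is a permutation of $\mathcal P\cup\mathcal B$ leaving $\mathcal P$ and $\mathcal B$ invariant setwise and preserving incidence; $\mathrm{Aut}(\mathcal D)$ is the group of all automorphisms. Two blocks are intersecting if some point is incident with both. For $G\le\mathrm{Aut}(\mathcal D)$, the $2$-design $\mathcal D$ is $G$-pairwise transitive if $G$ is transitive on each of the following five (possibly empty) sets of ordered pairs: pairs of distinct points, incident point-block pairs, non-incident point-block pairs, pairs of distinct intersecting blocks, pairs of non-intersecting blocks. $G^{\mathcal B}$ is the permutation group induced by $G$ on $\mathcal B$. A transitive permutation group has rank $n$ if a point stabiliser has exactly $n$ orbits. -}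

module Defs where

open import Level using (Level; 0ℓ; _⊔_) renaming (suc to lsuc)
open import Algebra.Bundles using (Group)
open import Data.Bool.Base using (Bool; T)
open import Data.Fin.Base using (Fin)
open import Data.Fin.Permutation as Perm using (Permutation′; _⟨$⟩ʳ_; _⟨$⟩ˡ_; _∘ₚ_)
open import Data.Fin.Subset using (Subset; _∈_; _∩_; ∣_∣)
open import Data.Nat.Base using (ℕ; _<_)
open import Data.Product.Base using (Σ; ∃-syntax; _×_; _,_; proj₁; proj₂; map; uncurry)
open import Data.Vec.Base using (tabulate)
open import Function.Bundles using (_⇔_; Bijection)
open import Relation.Binary.Bundles using (Setoid)
open import Relation.Binary.PropositionalEquality
  using (_≡_; _≢_; refl; sym; trans; cong; cong₂; setoid)
open import Relation.Nullary.Negation using (¬_)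
open import Relation.Unary using (Pred)

private
  variable
    c ℓ ℓ′ a p : Level
    m n v b : ℕ
    A B : Set a

record Subgroup (𝓖 : Group c ℓ) (ℓ′ : Level) : Set (c ⊔ ℓ ⊔ lsuc ℓ′) where
  open Group 𝓖 hiding (refl; sym; trans; setoid)
  field
    Member    : Pred Carrier ℓ′
    resp-≈    : ∀ {g h} → g ≈ h → Member g → Member h
    ε-closed  : Member ε
    ∙-closed  : ∀ {g h} → Member g → Member h → Member (g ∙ h)
    ⁻¹-closed : ∀ {g} → Member g → Member (g ⁻¹)

record Action (𝓖 : Group c ℓ) (X : Set a) : Set (c ⊔ ℓ ⊔ a) where
  open Group 𝓖 hiding (refl; sym; trans; setoid)
  field
    act      : Carrier → X → X
    act-cong : ∀ {g h} → g ≈ h → ∀ x → act g x ≡ act h x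
    act-ε    : ∀ x → act ε x ≡ x
    act-∙    : ∀ g h x → act (g ∙ h) x ≡ act g (act h x)

  act-⁻¹ : ∀ g {x y} → act g x ≡ y → act (g ⁻¹) y ≡ x
  act-⁻¹ g {x} refl =
    trans (sym (act-∙ (g ⁻¹) g x)) (trans (act-cong (inverseˡ g) x) (act-ε x))

_×ᵃ_ : {𝓖 : Group c ℓ} → Action 𝓖 A → Action 𝓖 B → Action 𝓖 (A × B)
α ×ᵃ β = record
  { act      = λ g → map (α.act g) (β.act g)
  ; act-cong = λ g≈h (x , y) → cong₂ _,_ (α.act-cong g≈h x) (β.act-cong g≈h y)
  ; act-ε    = λ (x , y) → cong₂ _,_ (α.act-ε x) (β.act-ε y)
  ; act-∙    = λ g h (x , y) → cong₂ _,_ (α.act-∙ g h x) (β.act-∙ g h y)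
  }
  where
  module α = Action α
  module β = Action β

module _ {𝓖 : Group c ℓ} {X : Set a} (α : Action 𝓖 X) (H : Subgroup 𝓖 ℓ′) where
  open Group 𝓖 hiding (refl; sym; trans; setoid)
  open Action α
  open Subgroup H

  stabiliser : X → Subgroup 𝓖 (ℓ′ ⊔ a)
  stabiliser x = record
    { Member    = λ g → Member g × act g x ≡ x
    ; resp-≈    = λ g≈h (g∈ , gx) → resp-≈ g≈h g∈ , trans (sym (act-cong g≈h x)) gx
    ; ε-closed  = ε-closed , act-ε x
    ; ∙-closed  = λ {g} {h} (g∈ , gx) (h∈ , hx) →
                    ∙-closed g∈ h∈ , trans (act-∙ g h x) (trans (cong (act g) hx) gx)
    ; ⁻¹-closed = λ {g} (g∈ , gx) → ⁻¹-closed g∈ , act-⁻¹ g gx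
    }

  Orbit : X → Pred X (c ⊔ ℓ′ ⊔ a)
  Orbit x y = ∃[ g ] Member g × act g x ≡ y

  -- The elements of X up to lying in the same orbit, i.e. the set of orbits.
  Orbits : Setoid a (c ⊔ ℓ′ ⊔ a)
  Orbits = record
    { Carrier       = X
    ; _≈_           = Orbit
    ; isEquivalence = record
      { refl  = λ {x} → ε , ε-closed , act-ε x
      ; sym   = λ (g , g∈ , gx≡y) → g ⁻¹ , ⁻¹-closed g∈ , act-⁻¹ g gx≡y
      ; trans = λ {x} (g , g∈ , gx≡y) (h , h∈ , hy≡z) →
                  h ∙ g , ∙-closed h∈ g∈ ,
                  trans (act-∙ h g x) (trans (cong (act h) gx≡y) hy≡z)
      }
    }

  HasOrbitCount : ℕ → Set (c ⊔ ℓ′ ⊔ a)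
  HasOrbitCount n = Bijection (setoid (Fin n)) Orbits

  -- Intended for H-invariant S; vacuously true when S is empty.
  TransitiveOn : Pred X p → Set (c ⊔ ℓ′ ⊔ a ⊔ p)
  TransitiveOn S = ∀ {x y} → S x → S y → Orbit x y

  Transitive : Set (c ⊔ ℓ′ ⊔ a)
  Transitive = ∀ x y → Orbit x y

HasSize : Pred (Fin n) p → ℕ → Set p
HasSize {n} P k = Σ (Subset n) λ S → (∀ x → x ∈ S ⇔ P x) × ∣ S ∣ ≡ k

-- Functions compose right to left, so that the natural action is a left action
-- (the library's π ∘ₚ ρ applies π first).
Sym : ℕ → Group 0ℓ 0ℓ
Sym n = record
  { Carrier = Permutation′ n
  ; _≈_     = Perm._≈_
  ; _∙_     = λ σ τ → τ ∘ₚ σ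
  ; ε       = Perm.id
  ; _⁻¹     = Perm.flip
  ; isGroup = record
    { isMonoid = record
      { isSemigroup = record
        { isMagma = record
          { isEquivalence = record
            { refl  = λ _ → refl
            ; sym   = λ σ≈τ i → sym (σ≈τ i)
            ; trans = λ σ≈τ τ≈υ i → trans (σ≈τ i) (τ≈υ i)
            }
          ; ∙-cong = λ {σ} {σ′} {τ} {τ′} σ≈σ′ τ≈τ′ i →
                       trans (cong (σ ⟨$⟩ʳ_) (τ≈τ′ i)) (σ≈σ′ (τ′ ⟨$⟩ʳ i))
          }
        ; assoc = λ _ _ _ _ → refl
        }
      ; identity = (λ _ _ → refl) , (λ _ _ → refl)
      }
    ; inverse = (λ σ _ → Perm.inverseˡ σ) , (λ σ _ → Perm.inverseʳ σ)
    ; ⁻¹-cong = λ {σ} {τ} σ≈τ i →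
        trans (sym (Perm.inverseˡ τ))
          (cong (τ ⟨$⟩ˡ_) (trans (sym (σ≈τ (σ ⟨$⟩ˡ i))) (Perm.inverseʳ σ)))
    }
  }

natural : Action (Sym n) (Fin n)
natural = record
  { act      = _⟨$⟩ʳ_
  ; act-cong = λ σ≈τ → σ≈τ
  ; act-ε    = λ _ → refl
  ; act-∙    = λ _ _ _ → refl
  }

-- Since the group is transitive, its point stabilisers are conjugate, so that
-- it does not matter which one is used to count orbits.
HasRank : Subgroup (Sym m) ℓ → ℕ → Set ℓ
HasRank H n =
  Transitive natural H × (∃[ x ] HasOrbitCount natural (stabiliser natural H x) n)

-- Points are Fin v and blocks are Fin b.  Distinct blocks may be incident with
-- the same points.
record Design (v b : ℕ) : Set where
  field
    incident? : Fin v → Fin b → Bool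

  Incident : Fin v → Fin b → Set
  Incident x B = T (incident? x B)

  pointsOn : Fin b → Subset v
  pointsOn B = tabulate λ x → incident? x B

  blocksThrough : Fin v → Subset b
  blocksThrough x = tabulate λ B → incident? x B

  Intersecting : Fin b → Fin b → Set
  Intersecting B C = ∃[ x ] Incident x B × Incident x C

record Is2Design (D : Design v b) (k lam : ℕ) : Set where
  open Design D
  field
    block-size : ∀ B → ∣ pointsOn B ∣ ≡ k
    pair-count : ∀ {x y} → x ≢ y → ∣ blocksThrough x ∩ blocksThrough y ∣ ≡ lam

NonTrivial : (v k : ℕ) → Set
NonTrivial v k = 2 < k × k < v

module _ (D : Design v b) where
  open Design D

  -- A permutation of the disjoint union of points and blocks that leaves both
  -- parts invariant is a pair of permutations, one of each part.
  record Automorphism : Set where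
    field
      onPoints  : Permutation′ v
      onBlocks  : Permutation′ b
      preserves : ∀ x B → incident? (onPoints ⟨$⟩ʳ x) (onBlocks ⟨$⟩ʳ B) ≡ incident? x B

  open Automorphism

  Aut : Group 0ℓ 0ℓ
  Aut = record
    { Carrier = Automorphism
    ; _≈_     = λ g h → (onPoints g P.≈ onPoints h) × (onBlocks g Q.≈ onBlocks h)
    ; _∙_     = λ g h → record
        { onPoints  = onPoints g P.∙ onPoints h
        ; onBlocks  = onBlocks g Q.∙ onBlocks h
        ; preserves = λ x B → trans (preserves g _ _) (preserves h x B)
        }
    ; ε       = record
        { onPoints  = P.ε
        ; onBlocks  = Q.ε
        ; preserves = λ _ _ → refl
        }
    ; _⁻¹     = λ g → record
        { onPoints  = onPoints g P.⁻¹
        ; onBlocks  = onBlocks g Q.⁻¹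
        ; preserves = λ x B →
            trans (sym (preserves g _ _))
              (cong₂ incident? (Perm.inverseʳ (onPoints g)) (Perm.inverseʳ (onBlocks g)))
        }
    ; isGroup = record
      { isMonoid = record
        { isSemigroup = record
          { isMagma = record
            { isEquivalence = record
              { refl  = (λ _ → refl) , (λ _ → refl)
              ; sym   = λ {g} {h} (p , q) →
                  P.sym {onPoints g} {onPoints h} p , Q.sym {onBlocks g} {onBlocks h} q
              ; trans = λ {g} {h} {k} (p , q) (p′ , q′) →
                  P.trans {onPoints g} {onPoints h} {onPoints k} p p′ ,
                  Q.trans {onBlocks g} {onBlocks h} {onBlocks k} q q′
              }
            ; ∙-cong = λ {g} {g′} {h} {h′} (p , q) (p′ , q′) →
                P.∙-cong {onPoints g} {onPoints g′} {onPoints h} {onPoints h′} p p′ ,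
                Q.∙-cong {onBlocks g} {onBlocks g′} {onBlocks h} {onBlocks h′} q q′
            }
          ; assoc = λ _ _ _ → (λ _ → refl) , (λ _ → refl)
          }
        ; identity = (λ _ → (λ _ → refl) , (λ _ → refl)) ,
                     (λ _ → (λ _ → refl) , (λ _ → refl))
        }
      ; inverse = (λ g → P.inverseˡ (onPoints g) , Q.inverseˡ (onBlocks g)) ,
                  (λ g → P.inverseʳ (onPoints g) , Q.inverseʳ (onBlocks g))
      ; ⁻¹-cong = λ {g} {h} (p , q) →
          P.⁻¹-cong {onPoints g} {onPoints h} p , Q.⁻¹-cong {onBlocks g} {onBlocks h} q
      }
    }
    where
    module P = Group (Sym v)
    module Q = Group (Sym b)

  pointAction : Action Aut (Fin v)
  pointAction = record
    { act      = λ g x → onPoints g ⟨$⟩ʳ x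
    ; act-cong = proj₁
    ; act-ε    = λ _ → refl
    ; act-∙    = λ _ _ _ → refl
    }

  blockAction : Action Aut (Fin b)
  blockAction = record
    { act      = λ g B → onBlocks g ⟨$⟩ʳ B
    ; act-cong = proj₂
    ; act-ε    = λ _ → refl
    ; act-∙    = λ _ _ _ → refl
    }

  inducedOnBlocks : Subgroup Aut ℓ → Subgroup (Sym b) ℓ
  inducedOnBlocks G = record
    { Member    = λ τ → ∃[ g ] Member g × (onBlocks g Q.≈ τ)
    ; resp-≈    = λ {σ} {τ} σ≈τ (g , g∈ , g≈σ) →
                    g , g∈ , Q.trans {onBlocks g} {σ} {τ} g≈σ σ≈τ
    ; ε-closed  = A.ε , ε-closed , λ _ → refl
    ; ∙-closed  = λ {σ} {τ} (g , g∈ , g≈σ) (h , h∈ , h≈τ) →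
                    g A.∙ h , ∙-closed g∈ h∈ ,
                    Q.∙-cong {onBlocks g} {σ} {onBlocks h} {τ} g≈σ h≈τ
    ; ⁻¹-closed = λ {σ} (g , g∈ , g≈σ) →
                    g A.⁻¹ , ⁻¹-closed g∈ , Q.⁻¹-cong {onBlocks g} {σ} g≈σ
    }
    where
    open Subgroup G
    module A = Group Aut
    module Q = Group (Sym b)

  record PairwiseTransitive (G : Subgroup Aut ℓ) : Set ℓ where
    field
      distinct-points :
        TransitiveOn (pointAction ×ᵃ pointAction) G (uncurry λ x y → x ≢ y)
      incident-pairs :
        TransitiveOn (pointAction ×ᵃ blockAction) G (uncurry λ x B → Incident x B)
      non-incident-pairs :
        TransitiveOn (pointAction ×ᵃ blockAction) G (uncurry λ x B → ¬ Incident x B)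
      intersecting-blocks :
        TransitiveOn (blockAction ×ᵃ blockAction) G
          (uncurry λ B C → B ≢ C × Intersecting B C)
      non-intersecting-blocks :
        TransitiveOn (blockAction ×ᵃ blockAction) G
          (uncurry λ B C → ¬ Intersecting B C)

{-# OPTIONS --safe #-}
-- Rank 3 forces two disjoint blocks: if every block met B, then G_B, being
-- transitive on the blocks other than B that meet B, would have at most two
-- orbits on blocks.  Disjoint blocks give 2k ≤ v.  The rest is counting:
-- v r = |B| k turns this into 2r ≤ |B|, and r (k − 1) = λ (v − 1) > 2 (k − 1)
-- gives r > 2.
module Submission where

open import Defs
open import Level using (Level)
open import Data.Bool.Base using (Bool; true; false; T; _∧_; if_then_else_)
open import Data.Bool.Properties using (T-≡; T?)
open import Data.Fin.Base using (Fin; zero; suc; punchIn)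
open import Data.Fin.Properties using (_≟_; any?; pigeonhole; <⇒≢; punchInᵢ≢i)
open import Data.Fin.Subset using (Subset; _∈_; _∩_; ∁; ∣_∣; Nonempty)
open import Data.Fin.Subset.Properties
  using (∣p∣≤n; ∣∁p∣≡n∸∣p∣; p⊆q⇒∣p∣≤∣q∣; x∉p⇒x∈∁p; ∩-idem; nonempty?; Empty-unique; ∣⊥∣≡0)
open import Data.Nat.Base using (ℕ; zero; suc; _≤_; _<_; _+_; _*_; z<s; s<s; s≤s⁻¹; NonZero; ≢-nonZero)
open import Data.Nat.Properties
  using ( +-*-semiring; +-identityʳ; +-suc; +-cancelˡ-≡; *-suc; *-comm; *-assoc; *-zeroʳ
        ; *-cancelʳ-≡; *-cancelʳ-≤; *-cancelʳ-<; *-monoʳ-≤; m*n≡0⇒m≡0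
        ; m≤m*n; m≤o∸n⇒m+n≤o; module ≤-Reasoning)
open import Algebra.Properties.Semiring.Sum +-*-semiring
  using (sum; sum-syntax; sum-cong-≗; sum-remove; ∑-comm; *-distribʳ-sum)
open import Data.Product.Base using (_×_; _,_; proj₁; proj₂; ∃-syntax)
open import Data.Vec.Base using ([]; _∷_; lookup; tabulate)
open import Data.Vec.Properties using (lookup∘tabulate; lookup-zipWith; []=⇒lookup; lookup⇒[]=)
open import Function.Base using (_∘_)
open import Function.Bundles using (_⇔_; mk⇔; module Equivalence; module Bijection)
open import Relation.Binary.Bundles using (module Setoid)
open import Relation.Binary.PropositionalEquality
  using (_≡_; _≢_; refl; sym; trans; cong; cong₂; subst; module ≡-Reasoning)
open import Relation.Nullary.Decidable using (Dec; yes; no; ¬?; _×-dec_; decidable-stable)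
open import Relation.Nullary.Negation using (¬_; contradiction)

private
  variable
    ℓ : Level
    n v b k lam : ℕ

⟦_⟧ : Bool → ℕ
⟦ c ⟧ = if c then 1 else 0

⟦∧⟧ : ∀ c d → ⟦ c ∧ d ⟧ ≡ ⟦ c ⟧ * ⟦ d ⟧
⟦∧⟧ true  d = sym (+-identityʳ ⟦ d ⟧)
⟦∧⟧ false d = refl

∣p∣≡∑ : (p : Subset n) → ∣ p ∣ ≡ ∑[ i < n ] ⟦ lookup p i ⟧
∣p∣≡∑ []          = refl
∣p∣≡∑ (true  ∷ p) = cong suc (∣p∣≡∑ p)
∣p∣≡∑ (false ∷ p) = ∣p∣≡∑ p

∣tabulate∣≡∑ : (f : Fin n → Bool) → ∣ tabulate f ∣ ≡ ∑[ i < n ] ⟦ f i ⟧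
∣tabulate∣≡∑ f = trans (∣p∣≡∑ (tabulate f)) (sum-cong-≗ (cong ⟦_⟧ ∘ lookup∘tabulate f))

∣tabulate∩tabulate∣≡∑ : (f g : Fin n → Bool) →
  ∣ tabulate f ∩ tabulate g ∣ ≡ ∑[ i < n ] (⟦ f i ⟧ * ⟦ g i ⟧)
∣tabulate∩tabulate∣≡∑ f g = trans (∣p∣≡∑ (tabulate f ∩ tabulate g)) (sum-cong-≗ pointwise)
  where
  pointwise : ∀ i → ⟦ lookup (tabulate f ∩ tabulate g) i ⟧ ≡ ⟦ f i ⟧ * ⟦ g i ⟧
  pointwise i = trans
    (cong ⟦_⟧ (trans (lookup-zipWith _∧_ i (tabulate f) (tabulate g))
                     (cong₂ _∧_ (lookup∘tabulate f i) (lookup∘tabulate g i))))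
    (⟦∧⟧ (f i) (g i))

∈-tabulate : (f : Fin n → Bool) (i : Fin n) → i ∈ tabulate f ⇔ T (f i)
∈-tabulate f i = mk⇔
  (λ i∈ → Equivalence.from T-≡ (trans (sym (lookup∘tabulate f i)) ([]=⇒lookup i∈)))
  (λ t → lookup⇒[]= i (tabulate f) (trans (lookup∘tabulate f i) (Equivalence.to T-≡ t)))

∑-const : ∀ {f : Fin n → ℕ} {c} → (∀ i → f i ≡ c) → sum f ≡ n * c
∑-const {zero}  f≗c = refl
∑-const {suc n} f≗c = cong₂ _+_ (f≗c zero) (∑-const (f≗c ∘ suc))

0<∣p∣⇒Nonempty : (p : Subset n) → 0 < ∣ p ∣ → Nonempty p
0<∣p∣⇒Nonempty {n} p 0<∣p∣ with nonempty? p
... | yes ne = ne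
... | no ¬ne = contradiction (subst (0 <_) (trans (cong ∣_∣ (Empty-unique ¬ne)) (∣⊥∣≡0 n)) 0<∣p∣) λ ()

disjoint⇒∣p∣+∣q∣≤n : (p q : Subset n) → (∀ {x} → x ∈ p → ¬ x ∈ q) → ∣ p ∣ + ∣ q ∣ ≤ n
disjoint⇒∣p∣+∣q∣≤n {n} p q disjoint = m≤o∸n⇒m+n≤o ∣ p ∣ (∣p∣≤n q)
  (subst (∣ p ∣ ≤_) (∣∁p∣≡n∸∣p∣ q) (p⊆q⇒∣p∣≤∣q∣ (x∉p⇒x∈∁p ∘ disjoint)))

-- Here v and k are one less than the parameters of the design.
module _ {v b k lam : ℕ} {D : Design (suc v) b} (is2 : Is2Design D (suc k) lam) where
  open Design D
  open Is2Design is2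
  open ≡-Reasoning

  private
    r : Fin (suc v) → ℕ
    r x = ∣ blocksThrough x ∣

    I : Fin (suc v) → Fin b → ℕ
    I x B = ⟦ incident? x B ⟧

    ∑I≡size : ∀ B → ∑[ x < suc v ] I x B ≡ suc k
    ∑I≡size B = trans (sym (∣tabulate∣≡∑ λ x → incident? x B)) (block-size B)

  -- Counts the pairs (y , B) with x and y both incident with B.
  r*k≡v*λ : ∀ x → r x * k ≡ v * lam
  r*k≡v*λ x = +-cancelˡ-≡ (r x) _ _ (begin
    r x + r x * k                                     ≡⟨ *-suc (r x) k ⟨
    r x * suc k                                       ≡⟨ cong (_* suc k) (∣tabulate∣≡∑ (incident? x)) ⟩
    (∑[ B < b ] I x B) * suc k                        ≡⟨ *-distribʳ-sum (suc k) (I x) ⟩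
    ∑[ B < b ] (I x B * suc k)                        ≡⟨ sum-cong-≗ column ⟨
    ∑[ B < b ] ∑[ y < suc v ] (I y B * I x B)         ≡⟨ ∑-comm (λ B y → I y B * I x B) ⟩
    ∑[ y < suc v ] ∑[ B < b ] (I y B * I x B)         ≡⟨ sum-cong-≗ row ⟨
    ∑[ y < suc v ] common y                           ≡⟨ sum-remove {i = x} common ⟩
    common x + ∑[ i < v ] common (punchIn x i)        ≡⟨ cong₂ _+_ (cong ∣_∣ (∩-idem (blocksThrough x)))
                                                           (∑-const λ i → pair-count (punchInᵢ≢i x i)) ⟩
    r x + v * lam                                     ∎)
    where
    common : Fin (suc v) → ℕ
    common y = ∣ blocksThrough y ∩ blocksThrough x ∣

    row : ∀ y → common y ≡ ∑[ B < b ] (I y B * I x B)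
    row y = ∣tabulate∩tabulate∣≡∑ (incident? y) (incident? x)

    column : ∀ B → ∑[ y < suc v ] (I y B * I x B) ≡ I x B * suc k
    column B = begin
      ∑[ y < suc v ] (I y B * I x B)   ≡⟨ *-distribʳ-sum (I x B) (λ y → I y B) ⟨
      (∑[ y < suc v ] I y B) * I x B   ≡⟨ cong (_* I x B) (∑I≡size B) ⟩
      suc k * I x B                    ≡⟨ *-comm (suc k) (I x B) ⟩
      I x B * suc k                    ∎

  r-constant : .{{_ : NonZero k}} → ∀ x y → r x ≡ r y
  r-constant x y = *-cancelʳ-≡ (r x) (r y) k (trans (r*k≡v*λ x) (sym (r*k≡v*λ y)))

  v*r≡b*k : .{{_ : NonZero k}} → ∀ x → suc v * r x ≡ b * suc k
  v*r≡b*k x = begin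
    suc v * r x                             ≡⟨ ∑-const (λ y → r-constant y x) ⟨
    ∑[ y < suc v ] r y                      ≡⟨ sum-cong-≗ (λ y → ∣tabulate∣≡∑ (incident? y)) ⟩
    ∑[ y < suc v ] ∑[ B < b ] I y B         ≡⟨ ∑-comm I ⟩
    ∑[ B < b ] ∑[ y < suc v ] I y B         ≡⟨ ∑-const ∑I≡size ⟩
    b * suc k                               ∎

  λ≢0 : .{{_ : NonZero k}} → Fin b → Fin (suc v) → lam ≢ 0
  λ≢0 B x refl = b≢0 B (m*n≡0⇒m≡0 b (suc k) (begin
    b * suc k     ≡⟨ v*r≡b*k x ⟨
    suc v * r x   ≡⟨ cong (suc v *_) r≡0 ⟩
    suc v * 0     ≡⟨ *-zeroʳ (suc v) ⟩
    0             ∎))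
    where
    r≡0 : r x ≡ 0
    r≡0 = m*n≡0⇒m≡0 (r x) k (trans (r*k≡v*λ x) (*-zeroʳ v))

    b≢0 : Fin b → b ≢ 0
    b≢0 () refl

module _ .{{_ : NonZero k}} {D : Design (suc v) b}
         (is2 : Is2Design D (suc k) lam) (2k≤v : 2 * suc k ≤ suc v) (x : Fin (suc v)) where
  open ≤-Reasoning

  private
    r : ℕ
    r = ∣ Design.blocksThrough D x ∣

  2r≤b : 2 * r ≤ b
  2r≤b = *-cancelʳ-≤ _ _ (suc v) (begin
    2 * r * suc v     ≡⟨ *-assoc 2 r (suc v) ⟩
    2 * (r * suc v)   ≡⟨ cong (2 *_) (trans (*-comm r (suc v)) (v*r≡b*k is2 x)) ⟩
    2 * (b * suc k)   ≡⟨ *-assoc 2 b (suc k) ⟨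
    2 * b * suc k     ≡⟨ cong (_* suc k) (*-comm 2 b) ⟩
    b * 2 * suc k     ≡⟨ *-assoc b 2 (suc k) ⟩
    b * (2 * suc k)   ≤⟨ *-monoʳ-≤ b 2k≤v ⟩
    b * suc v         ∎)

  3≤r : Fin b → 3 ≤ r
  3≤r B = *-cancelʳ-< k 2 r (begin-strict
    2 * k      <⟨ subst (_≤ v) (+-suc k (k + 0)) (s≤s⁻¹ 2k≤v) ⟩
    v          ≤⟨ m≤m*n v lam {{≢-nonZero (λ≢0 is2 B x)}} ⟩
    v * lam    ≡⟨ r*k≡v*λ is2 x ⟨
    r * k      ∎)

module _ (D : Design v b) where
  open Design D

  intersecting? : ∀ B C → Dec (Intersecting B C)
  intersecting? B C = any? λ x → T? (incident? x B) ×-dec T? (incident? x C)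

  disjoint-blocks⇒2k≤v : Is2Design D k lam → ∀ {B C} → ¬ Intersecting B C → 2 * k ≤ v
  disjoint-blocks⇒2k≤v {k = k} is2 {B} {C} disjoint =
    subst (_≤ v)
      (cong₂ _+_ (block-size B) (trans (block-size C) (sym (+-identityʳ k))))
      (disjoint⇒∣p∣+∣q∣≤n (pointsOn B) (pointsOn C) λ {x} x∈B x∈C →
        disjoint (x , Equivalence.to (∈-tabulate _ x) x∈B , Equivalence.to (∈-tabulate _ x) x∈C))
    where open Is2Design is2

  module _ (G : Subgroup (Aut D) ℓ) (pt : PairwiseTransitive D G) where
    open PairwiseTransitive pt

    private
      Gᴮ : Subgroup (Sym b) ℓ
      Gᴮ = inducedOnBlocks D G

    rank3⇒disjoint-blocks : HasRank Gᴮ 3 → ∃[ B ] ∃[ C ] ¬ Intersecting B C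
    rank3⇒disjoint-blocks (_ , B , bij) with any? (λ i → ¬? (intersecting? B (Bijection.to bij i)))
    ... | yes (i , disjoint) = B , Bijection.to bij i , disjoint
    ... | no all-meet =
      let i , j , i<j , sameClass = pigeonhole (s<s (s<s z<s)) class
      in contradiction (Bijection.injective bij (sameOrbit i j sameClass)) (<⇒≢ i<j)
      where
      C : Fin 3 → Fin b
      C = Bijection.to bij

      class : Fin 3 → Fin 2
      class i with B ≟ C i
      ... | yes _ = zero
      ... | no  _ = suc zero

      meets : ∀ i → Intersecting B (C i)
      meets i = decidable-stable (intersecting? B (C i)) λ disjoint → all-meet (i , disjoint)

      sameOrbit : ∀ i j → class i ≡ class j → Orbit natural (stabiliser natural Gᴮ B) (C i) (C j)
      sameOrbit i j eq with B ≟ C i | B ≟ C j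
      sameOrbit i j eq | yes B≡Cᵢ | yes B≡Cⱼ =
        Setoid.reflexive (Orbits natural (stabiliser natural Gᴮ B)) (trans (sym B≡Cᵢ) B≡Cⱼ)
      sameOrbit i j eq | no B≢Cᵢ | no B≢Cⱼ
        with g , g∈ , moves ← intersecting-blocks (B≢Cᵢ , meets i) (B≢Cⱼ , meets j) =
        Automorphism.onBlocks g , ((g , g∈ , λ _ → refl) , cong proj₁ moves) , cong proj₂ moves
      sameOrbit i j () | yes _ | no _
      sameOrbit i j () | no _ | yes _

    stabiliser-orbit : Is2Design D k lam → 0 < k → ∀ B →
      ∃[ x ] HasSize (Orbit (pointAction D) (stabiliser (blockAction D) G B) x) k
    stabiliser-orbit is2 0<k B
      with x , x∈B ← 0<∣p∣⇒Nonempty (pointsOn B) (subst (0 <_) (sym (Is2Design.block-size is2 B)) 0<k) =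
      x , pointsOn B , (λ y → mk⇔ (reach y) (stay y)) , Is2Design.block-size is2 B
      where
      xIB : Incident x B
      xIB = Equivalence.to (∈-tabulate _ x) x∈B

      reach : ∀ y → y ∈ pointsOn B → Orbit (pointAction D) (stabiliser (blockAction D) G B) x y
      reach y y∈B with g , g∈ , moves ← incident-pairs xIB (Equivalence.to (∈-tabulate _ y) y∈B) =
        g , (g∈ , cong proj₂ moves) , cong proj₁ moves

      stay : ∀ y → Orbit (pointAction D) (stabiliser (blockAction D) G B) x y → y ∈ pointsOn B
      stay y (g , (_ , gB≡B) , gx≡y) = Equivalence.from (∈-tabulate _ y)
        (subst T (trans (sym (Automorphism.preserves g x B)) (cong₂ incident? gx≡y gB≡B)) xIB)

lemma4p1 : ∀ {ℓ : Level} {v b k lam : ℕ} (D : Design v b) (G : Subgroup (Aut D) ℓ) →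
    Is2Design D k lam →
    NonTrivial v k →
    PairwiseTransitive D G →
    HasRank (inducedOnBlocks D G) 3 →
    (3 ≤ k × 2 * k ≤ v) ×
    ((x : Fin v) → let r = ∣ Design.blocksThrough D x ∣ in 3 ≤ r × 2 * r ≤ b) ×
    ((B : Fin b) → ∃[ x ] HasSize (Orbit (pointAction D) (stabiliser (blockAction D) G B) x) k)
lemma4p1 {v = suc _} {k = suc (suc _)} D G is2 (2<k@(s<s (s<s _)) , _) pt rank
  with B , _ , disjoint ← rank3⇒disjoint-blocks D G pt rank
  with 2k≤v ← disjoint-blocks⇒2k≤v D is2 disjoint =
  (2<k , 2k≤v) ,
  (λ x → 3≤r is2 2k≤v x B , 2r≤b is2 2k≤v x) ,
  stabiliser-orbit D G pt is2 z<s
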